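{- Let $q$ be a prime power and $n,m,k$ integers with $1<k<n$, $m<n\le km$, and either $m\ge4$, or $m=3$ and $n\ge5$. Let $\mathcal C$ be a nondegenerate $L_{\mathrm{rk}}$-optimal $[n,k,d]_{q^m/q}$ code. Then the dual code $\mathcal C^\perp$ is either degenerate or not $L_{\mathrm{rk}}$-optimal.
   Context: $\mathbb{F}_{q^m}$ is the degree-$m$ extension of $\mathbb{F}_q$. Rank weight of $\mathbf v=(v_1,\dots,v_n)\in\mathbb{F}_{q^m}^n$: $\mathrm{w}(\mathbf v)=\dim_{\mathbb{F}_q}\langle v_1,\dots,v_n\rangle_{\mathbb{F}_q}$. An $[n,k,d]_{q^m/q}$ code is a $k$-dimensional $\mathbb{F}_{q^m}$-subspace $\mathcal C\subseteq\mathbb{F}_{q^m}^n$ with minimum nonzero rank weight $d$; nondegenerate means the $\mathbb{F}_q$-span of the columns of a generator matrix has $\mathbb{F}_q$-dimension $n$. The dual code is $\mathcal C^\perp=\{\mathbf d\in\mathbb{F}_{q^m}^n:\sum_i c_id_i=0\ \forall\,\mathbf c\in\mathcal C\}$, an $[n,n-k]_{q^m/q}$ code. $\mathrm{WS}(\mathcal C)=\{\mathrm{w}(\mathbf c):\mathbf c\in\mathcal C\setminus\{\mathbf 0\}\}$; $L_{\mathrm{rk}}(n,m,k',q)$ is the maximum of $|\mathrm{WS}|$ over nondegenerate $[n,k']_{q^m/q}$ codes, and a nondegenerate $[n,k']_{q^m/q}$ code is $L_{\mathrm{rk}}$-optimal if its weight spectrum has size $L_{\mathrm{rk}}(n,m,k',q)$.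 -}

module Defs where

open import Level using (0ℓ)
open import Data.Nat using (ℕ; zero; suc; _^_; _≤_)
open import Data.Nat.Primality using (Prime)
open import Data.Fin using (Fin)
open import Data.Product using (Σ; ∃; ∃-syntax; _×_; _,_)
open import Function.Bundles using (_↔_)
open import Function.Definitions using (Injective)
open import Relation.Binary.PropositionalEquality using (_≡_)
open import Relation.Nullary using (¬_)
open import Algebra.Structures using (IsCommutativeRing)

IsPrimePower : ℕ → Set
IsPrimePower q = ∃[ p ] ∃[ r ] (Prime p × 1 ≤ r × q ≡ p ^ r)

record Field : Set₁ where
  infixl 7 _*_
  infixl 6 _+_
  field
    Carrier : Set
    _+_ _*_ : Carrier → Carrier → Carrier
    -_      : Carrier → Carrier
    0# 1#   : Carrier
    isCommutativeRing : IsCommutativeRing _≡_ _+_ _*_ -_ 0# 1#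
    0≢1     : ¬ (0# ≡ 1#)
    inverse : ∀ x → ¬ (x ≡ 0#) → ∃[ y ] (x * y ≡ 1#)

open Field

HasSize : Field → ℕ → Set
HasSize F N = Fin N ↔ Carrier F

-- Field homomorphism (embedding of the subfield F_q into F_{q^m}).
record FieldHom (K L : Field) : Set where
  field
    ⟦_⟧    : Carrier K → Carrier L
    hom-+  : ∀ x y → ⟦ _+_ K x y ⟧ ≡ _+_ L ⟦ x ⟧ ⟦ y ⟧
    hom-*  : ∀ x y → ⟦ _*_ K x y ⟧ ≡ _*_ L ⟦ x ⟧ ⟦ y ⟧
    hom-1  : ⟦ 1# K ⟧ ≡ 1# L

module Ext {K L : Field} (ι : FieldHom K L) where
  open FieldHom ι

  Vec : ℕ → Set
  Vec s = Fin s → Carrier L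

  sumL : (t : ℕ) → (Fin t → Carrier L) → Carrier L
  sumL zero    f = 0# L
  sumL (suc t) f = _+_ L (f Fin.zero) (sumL t (λ i → f (Fin.suc i)))

  combK : ∀ {s t} → (Fin t → Carrier K) → (Fin t → Vec s) → Vec s
  combK {s} {t} a v j = sumL t (λ i → _*_ L ⟦ a i ⟧ (v i j))

  combL : ∀ {s t} → (Fin t → Carrier L) → (Fin t → Vec s) → Vec s
  combL {s} {t} x v j = sumL t (λ i → _*_ L (x i) (v i j))

  _≋_ : ∀ {s} → Vec s → Vec s → Set
  u ≋ w = ∀ j → u j ≡ w j

  zeroV : ∀ {s} → Vec s
  zeroV _ = 0# L

  InSpanK : ∀ {s t} → Vec s → (Fin t → Vec s) → Set
  InSpanK {s} {t} u v = ∃[ a ] (u ≋ combK {s} {t} a v)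

  IndepK : ∀ {s t} → (Fin t → Vec s) → Set
  IndepK {s} {t} v = ∀ a → combK {s} {t} a v ≋ zeroV → ∀ i → a i ≡ 0# K

  IndepL : ∀ {s t} → (Fin t → Vec s) → Set
  IndepL {s} {t} v = ∀ x → combL {s} {t} x v ≋ zeroV → ∀ i → x i ≡ 0# L

  SpanDimK : ∀ {s t} → (Fin t → Vec s) → ℕ → Set
  SpanDimK {s} {t} v d =
    ∃[ b ] ( IndepK {s} {d} b
           × (∀ l → InSpanK {s} {t} (b l) v)
           × (∀ i → InSpanK {s} {d} (v i) b) )

  -- rank weight: w(v) = dim_K ⟨v_1,…,v_n⟩_K   (entries viewed in L = L^1)
  RankWeight : ∀ {n} → Vec n → ℕ → Set
  RankWeight {n} v w = SpanDimK {1} {n} (λ i _ → v i) w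

  -- Codes, given by a generator matrix G : k × n of full L-rank k.

  Matrix : ℕ → ℕ → Set
  Matrix k n = Fin k → Vec n

  IsGenMatrix : ∀ {k n} → Matrix k n → Set
  IsGenMatrix {k} {n} G = IndepL {n} {k} G

  InCode : ∀ {k n} → Matrix k n → Vec n → Set
  InCode {k} {n} G c = ∃[ x ] (c ≋ combL {n} {k} x G)

  column : ∀ {k n} → Matrix k n → Fin n → Vec k
  column G j i = G i j

  Nondegenerate : ∀ {k n} → Matrix k n → Set
  Nondegenerate {k} {n} G = SpanDimK {k} {n} (column G) n

  IsCode : ∀ n k → Matrix k n → Set
  IsCode n k G = IsGenMatrix {k} {n} G

  InWS : ∀ {k n} → Matrix k n → ℕ → Set
  InWS {k} {n} G w =
    ∃[ c ] (InCode G c × ¬ (c ≋ zeroV) × RankWeight {n} c w)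

  CardEq : (ℕ → Set) → ℕ → Set
  CardEq P N = Σ (Fin N → ℕ) λ f →
      (∀ i → P (f i))
    × Injective _≡_ _≡_ f
    × (∀ w → P w → ∃[ i ] (f i ≡ w))

  WSSize : ∀ {k n} → Matrix k n → ℕ → Set
  WSSize G N = CardEq (InWS G) N

  IsLrk : ℕ → ℕ → ℕ → Set
  IsLrk n k' N =
      (∃[ G ] (IsCode n k' G × Nondegenerate G × WSSize G N))
    × (∀ G → IsCode n k' G → Nondegenerate G → ∀ s → WSSize G s → s ≤ N)

  LrkOptimal : ∀ n k' → Matrix k' n → Set
  LrkOptimal n k' G =
    Nondegenerate G × ∃[ N ] (IsLrk n k' N × WSSize G N)

  dot : ∀ {n} → Vec n → Vec n → Carrier L
  dot {n} c d = sumL n (λ i → _*_ L (c i) (d i))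

  GeneratesDual : ∀ {k k' n} → Matrix k n → Matrix k' n → Set
  GeneratesDual {k} {k'} {n} G H =
    IsGenMatrix H ×
    (∀ d → InCode H d ↔' (∀ c → InCode G c → dot c d ≡ 0# L))
    where
    _↔'_ : Set → Set → Set
    A ↔' B = (A → B) × (B → A)

{-# OPTIONS --safe #-}

-- A codeword of weight 1 in a code is, up to a scalar, a vector over F_q; being orthogonal to
-- the dual code, it makes the dual degenerate. Now one of the two dimensions k and n − k is at
-- least n/2, and for such a dimension k there is a nondegenerate [n, k] code with weights
-- 1, …, m: a direct sum of one-dimensional codes of lengths 1 and 2 (and one of length 3 when
-- n = 2k). So an optimal code of that dimension has all the weights 1, …, m, and its dual is
-- degenerate.

module Submission where

open import Level using (0ℓ)
open import Algebra.Bundles using (CommutativeRing)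
import Algebra.Properties.Group as GroupProperties
open import Data.Empty using (⊥-elim)
open import Data.Fin using (Fin; zero; suc; splitAt; _↑ˡ_; _↑ʳ_; funToFin; finToFun; combine; toℕ; fromℕ<)
open import Data.Fin.Properties using (injective⇒≤; any?; all?; finToFun-funToFin; funToFin-finToFin; join-splitAt; toℕ<n; toℕ-injective; toℕ-fromℕ<)
import Data.Fin.Properties as Fin
open import Data.Nat using (ℕ; zero; suc; _+_; _^_; _≤_; _<_; _*_; _∸_; z≤n; s≤s; >-nonZero)
open import Data.Nat.Properties using (≤-refl; ≤-trans; ≤-reflexive; <-irrefl; <⇒≤; ≰⇒>; ≮⇒≥; ^-monoʳ-≤; ^-monoʳ-<; m≤n+m; m+[n∸m]≡n; m≤n⇒∃[o]m+o≡n; +-cancelˡ-<; +-cancelˡ-≤; +-monoˡ-≤; suc-injective; _≤?_; _<?_; _≟_)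
import Data.Nat.Properties as ℕ
import Data.Nat.Solver as ℕ-Solver
open import Data.Product using (_×_; _,_; proj₁; proj₂; ∃; ∃-syntax)
open import Data.Sum using (_⊎_; inj₁; inj₂)
open import Data.Vec.Functional using (_∷_; _++_)
open import Data.Vec.Functional.Properties using (lookup-++ˡ; lookup-++ʳ)
open import Defs
open import Function.Base using (_∘_)
open import Function.Bundles using (Inverse)
open import Function.Definitions using (Injective)
open import Relation.Binary.Definitions using (DecidableEquality)
open import Relation.Binary.PropositionalEquality using (_≡_; _≢_; _≗_; refl; sym; trans; cong; cong₂; subst; subst₂; module ≡-Reasoning)
open import Relation.Nullary using (¬_; Dec; yes; no)
open import Relation.Nullary.Decidable using (map′; _×-dec_; ¬?)

-- Finite index sets and injections between them.

↑-elim : ∀ {s n} (P : Fin (s + n) → Set) →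
         (∀ i → P (i ↑ˡ n)) → (∀ j → P (s ↑ʳ j)) → ∀ i → P i
↑-elim {s} {n} P l r i with splitAt s i | join-splitAt s n i
... | inj₁ a | refl = l a
... | inj₂ b | refl = r b

-- Adjoining the missed value `y` in front of `f` gives an injection from a set with one more
-- element.
injective∧missed⇒< : ∀ {A B} (f : Fin A → Fin B) → Injective _≡_ _≡_ f →
                     ∀ y → (∀ x → f x ≢ y) → A < B
injective∧missed⇒< {A} {B} f f-inj y missed = injective⇒≤ {f = y ∷ f} inj
  where
  inj : Injective _≡_ _≡_ (y ∷ f)
  inj {zero}  {zero}  _  = refl
  inj {zero}  {suc j} eq = ⊥-elim (missed j (sym eq))
  inj {suc i} {zero}  eq = ⊥-elim (missed i eq)
  inj {suc i} {suc j} eq = cong suc (f-inj eq)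

funToFin-cong : ∀ {t q} {f g : Fin t → Fin q} → f ≗ g → funToFin f ≡ funToFin g
funToFin-cong {zero}  f≗g = refl
funToFin-cong {suc t} f≗g = cong₂ combine (f≗g zero) (funToFin-cong (f≗g ∘ suc))

-- Finite fields and coefficient vectors as enumerated sets.

ring : Field → CommutativeRing 0ℓ 0ℓ
ring F = record { isCommutativeRing = Field.isCommutativeRing F }

module Enumeration (F : Field) {q : ℕ} (enum : HasSize F q) where
  open Field F using (Carrier; 0#; 1#; 0≢1)
  open Inverse enum using (to; from; strictlyInverseˡ; strictlyInverseʳ)

  from-injective : Injective _≡_ _≡_ from
  from-injective {x} {y} eq =
    trans (sym (strictlyInverseˡ x)) (trans (cong to eq) (strictlyInverseˡ y))

  to-injective : Injective _≡_ _≡_ to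
  to-injective {x} {y} eq =
    trans (sym (strictlyInverseʳ x)) (trans (cong from eq) (strictlyInverseʳ y))

  _≟ᶠ_ : DecidableEquality Carrier
  x ≟ᶠ y = map′ from-injective (cong from) (from x Fin.≟ from y)

  1<size : 1 < q
  1<size = injective∧missed⇒< {1} (λ _ → from 0#) inj (from 1#) (λ _ → 0≢1 ∘ from-injective)
    where
    inj : Injective _≡_ _≡_ (λ (_ : Fin 1) → from 0#)
    inj {zero} {zero} _ = refl

  encode : ∀ {t} → (Fin t → Carrier) → Fin (q ^ t)
  encode a = funToFin (from ∘ a)

  decode : ∀ t → Fin (q ^ t) → Fin t → Carrier
  decode t x = to ∘ finToFun {q} {t} x

  decode-encode : ∀ {t} (a : Fin t → Carrier) → decode t (encode a) ≗ a
  decode-encode a i =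
    trans (cong to (finToFun-funToFin (from ∘ a) i)) (strictlyInverseˡ (a i))

  encode-injective : ∀ {t} {a a′ : Fin t → Carrier} → encode a ≡ encode a′ → a ≗ a′
  encode-injective {t} {a} {a′} eq i =
    trans (sym (decode-encode a i)) (trans (cong (λ x → decode t x i) eq) (decode-encode a′ i))

  decode-injective : ∀ t {x y : Fin (q ^ t)} → decode t x ≗ decode t y → x ≡ y
  decode-injective t {x} {y} eq =
    trans (sym (funToFin-finToFin {t} x))
      (trans (funToFin-cong {f = finToFun {q} {t} x} {g = finToFun {q} {t} y} (to-injective ∘ eq))
        (funToFin-finToFin {t} y))

-- Linear algebra over `K` inside `L`.

module Linear {K L : Field} (ι : FieldHom K L) where
  open Ext ι
  open FieldHom ι
  module 𝕂 = CommutativeRing (ring K)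
  open CommutativeRing (ring L)
    using (+-identityˡ; +-identityʳ; +-assoc; +-group; *-assoc; *-comm; *-identityˡ; *-identityʳ;
           distribˡ; distribʳ; zeroˡ; zeroʳ)
    renaming (Carrier to 𝕃; _+_ to _⊕_; _*_ to _⊛_; 0# to 0ᴸ; 1# to 1ᴸ; +-comm to ⊕-comm)
  open ≡-Reasoning

  -- Additivity makes the image of zero equal to its own double.
  hom-0 : ⟦ 𝕂.0# ⟧ ≡ 0ᴸ
  hom-0 = GroupProperties.identityʳ-unique +-group _ _
    (trans (sym (hom-+ 𝕂.0# 𝕂.0#)) (cong ⟦_⟧ (𝕂.+-identityˡ _)))

  ⊛-cancelʳ : ∀ {x y z} → z ≢ 0ᴸ → x ⊛ z ≡ y ⊛ z → x ≡ y
  ⊛-cancelʳ {x} {y} {z} z≢0 eq = trans (sym (undo x)) (trans (cong (_⊛ z⁻¹) eq) (undo y))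
    where
    z⁻¹ = proj₁ (Field.inverse L z z≢0)
    undo : ∀ w → (w ⊛ z) ⊛ z⁻¹ ≡ w
    undo w = trans (*-assoc w z z⁻¹)
      (trans (cong (w ⊛_) (proj₂ (Field.inverse L z z≢0))) (*-identityʳ w))

  ⊛-nonzeroʳ : ∀ {x z} → z ≢ 0ᴸ → x ⊛ z ≡ 0ᴸ → x ≡ 0ᴸ
  ⊛-nonzeroʳ {z = z} z≢0 eq = ⊛-cancelʳ z≢0 (trans eq (sym (zeroˡ z)))

  hom-≢0 : ∀ {x} → x ≢ 𝕂.0# → ⟦ x ⟧ ≢ 0ᴸ
  hom-≢0 {x} x≢0 eq with Field.inverse K x x≢0
  ... | y , xy≡1 = Field.0≢1 L (begin
    0ᴸ              ≡⟨ sym (zeroˡ _) ⟩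
    0ᴸ ⊛ ⟦ y ⟧      ≡⟨ cong (_⊛ ⟦ y ⟧) (sym eq) ⟩
    ⟦ x ⟧ ⊛ ⟦ y ⟧   ≡⟨ sym (hom-* x y) ⟩
    ⟦ x 𝕂.* y ⟧     ≡⟨ cong ⟦_⟧ xy≡1 ⟩
    ⟦ 𝕂.1# ⟧        ≡⟨ hom-1 ⟩
    1ᴸ              ∎)

  Σ-cong : ∀ {t} {f g : Fin t → 𝕃} → f ≗ g → sumL t f ≡ sumL t g
  Σ-cong {zero}  f≗g = refl
  Σ-cong {suc t} f≗g = cong₂ _⊕_ (f≗g zero) (Σ-cong (f≗g ∘ suc))

  Σ-zero : ∀ {t} {f : Fin t → 𝕃} → (∀ i → f i ≡ 0ᴸ) → sumL t f ≡ 0ᴸ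
  Σ-zero {zero}  f≗0 = refl
  Σ-zero {suc t} f≗0 = trans (cong₂ _⊕_ (f≗0 zero) (Σ-zero (f≗0 ∘ suc))) (+-identityˡ 0ᴸ)

  ⊕-interchange : ∀ w x y z → (w ⊕ x) ⊕ (y ⊕ z) ≡ (w ⊕ y) ⊕ (x ⊕ z)
  ⊕-interchange w x y z = begin
    (w ⊕ x) ⊕ (y ⊕ z)   ≡⟨ +-assoc w x (y ⊕ z) ⟩
    w ⊕ (x ⊕ (y ⊕ z))   ≡⟨ cong (w ⊕_) (sym (+-assoc x y z)) ⟩
    w ⊕ ((x ⊕ y) ⊕ z)   ≡⟨ cong (λ e → w ⊕ (e ⊕ z)) (⊕-comm x y) ⟩
    w ⊕ ((y ⊕ x) ⊕ z)   ≡⟨ cong (w ⊕_) (+-assoc y x z) ⟩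
    w ⊕ (y ⊕ (x ⊕ z))   ≡⟨ sym (+-assoc w y (x ⊕ z)) ⟩
    (w ⊕ y) ⊕ (x ⊕ z)   ∎

  Σ-⊕ : ∀ {t} (f g : Fin t → 𝕃) → sumL t (λ i → f i ⊕ g i) ≡ sumL t f ⊕ sumL t g
  Σ-⊕ {zero}  f g = sym (+-identityˡ 0ᴸ)
  Σ-⊕ {suc t} f g = trans (cong ((f zero ⊕ g zero) ⊕_) (Σ-⊕ (f ∘ suc) (g ∘ suc)))
    (⊕-interchange (f zero) (g zero) _ _)

  Σ-⊛ˡ : ∀ {t} c (f : Fin t → 𝕃) → sumL t (λ i → c ⊛ f i) ≡ c ⊛ sumL t f
  Σ-⊛ˡ {zero}  c f = sym (zeroʳ c)
  Σ-⊛ˡ {suc t} c f = trans (cong ((c ⊛ f zero) ⊕_) (Σ-⊛ˡ c (f ∘ suc))) (sym (distribˡ c _ _))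

  Σ-split : ∀ s {t} (f : Fin (s + t) → 𝕃) →
            sumL (s + t) f ≡ sumL s (f ∘ (_↑ˡ t)) ⊕ sumL t (f ∘ (s ↑ʳ_))
  Σ-split zero    f = sym (+-identityˡ _)
  Σ-split (suc s) f = trans (cong (f zero ⊕_) (Σ-split s (f ∘ suc))) (sym (+-assoc _ _ _))

  combK-congˡ : ∀ {s t} {a a′ : Fin t → 𝕂.Carrier} (v : Fin t → Vec s) →
                a ≗ a′ → combK a v ≋ combK a′ v
  combK-congˡ v a≗a′ j = Σ-cong (λ i → cong (λ e → ⟦ e ⟧ ⊛ v i j) (a≗a′ i))

  combK-zero : ∀ {s t} {a : Fin t → 𝕂.Carrier} (v : Fin t → Vec s) →
               (∀ i → a i ≡ 𝕂.0#) → combK a v ≋ zeroV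
  combK-zero v a≗0 j = Σ-zero (λ i →
    trans (cong (_⊛ v i j) (trans (cong ⟦_⟧ (a≗0 i)) hom-0)) (zeroˡ _))

  combK-linear : ∀ {s t} c (a a′ : Fin t → 𝕂.Carrier) (v : Fin t → Vec s) j →
    combK (λ i → c 𝕂.* a i 𝕂.+ a′ i) v j ≡ (⟦ c ⟧ ⊛ combK a v j) ⊕ combK a′ v j
  combK-linear {t = t} c a a′ v j = begin
    sumL _ (λ i → ⟦ c 𝕂.* a i 𝕂.+ a′ i ⟧ ⊛ v i j)
      ≡⟨ Σ-cong term ⟩
    sumL _ (λ i → (⟦ c ⟧ ⊛ (⟦ a i ⟧ ⊛ v i j)) ⊕ (⟦ a′ i ⟧ ⊛ v i j))
      ≡⟨ Σ-⊕ {t} _ _ ⟩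
    sumL _ (λ i → ⟦ c ⟧ ⊛ (⟦ a i ⟧ ⊛ v i j)) ⊕ combK a′ v j
      ≡⟨ cong (_⊕ combK a′ v j) (Σ-⊛ˡ {t} ⟦ c ⟧ _) ⟩
    (⟦ c ⟧ ⊛ combK a v j) ⊕ combK a′ v j ∎
    where
    term : ∀ i → ⟦ c 𝕂.* a i 𝕂.+ a′ i ⟧ ⊛ v i j
               ≡ (⟦ c ⟧ ⊛ (⟦ a i ⟧ ⊛ v i j)) ⊕ (⟦ a′ i ⟧ ⊛ v i j)
    term i = begin
      ⟦ c 𝕂.* a i 𝕂.+ a′ i ⟧ ⊛ v i j
        ≡⟨ cong (_⊛ v i j) (trans (hom-+ _ _) (cong (_⊕ ⟦ a′ i ⟧) (hom-* c (a i)))) ⟩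
      ((⟦ c ⟧ ⊛ ⟦ a i ⟧) ⊕ ⟦ a′ i ⟧) ⊛ v i j
        ≡⟨ distribʳ (v i j) _ _ ⟩
      ((⟦ c ⟧ ⊛ ⟦ a i ⟧) ⊛ v i j) ⊕ (⟦ a′ i ⟧ ⊛ v i j)
        ≡⟨ cong (_⊕ (⟦ a′ i ⟧ ⊛ v i j)) (*-assoc ⟦ c ⟧ ⟦ a i ⟧ (v i j)) ⟩
      (⟦ c ⟧ ⊛ (⟦ a i ⟧ ⊛ v i j)) ⊕ (⟦ a′ i ⟧ ⊛ v i j) ∎

  combK-injective : ∀ {s t} {v : Fin t → Vec s} → IndepK v →
                    ∀ {a a′} → combK a v ≋ combK a′ v → a ≗ a′
  combK-injective {v = v} indep {a} {a′} eq i = 𝕂.trans a≡ (𝕂.sym (inverseʳ-unique _ _ diff≡0))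
    where
    open GroupProperties 𝕂.+-group using (inverseʳ-unique)
    -- The difference is taken as `-1# * a + a′`, the shape that `combK-linear` handles; `a` and
    -- `a′` are then both the additive inverse of `-1# * a`.
    -1# = 𝕂.- 𝕂.1#
    diff≡0 : -1# 𝕂.* a i 𝕂.+ a′ i ≡ 𝕂.0#
    diff≡0 = indep (λ l → -1# 𝕂.* a l 𝕂.+ a′ l) (λ j → begin
      combK (λ l → -1# 𝕂.* a l 𝕂.+ a′ l) v j
        ≡⟨ combK-linear -1# a a′ v j ⟩
      (⟦ -1# ⟧ ⊛ combK a v j) ⊕ combK a′ v j
        ≡⟨ cong₂ _⊕_ (cong (⟦ -1# ⟧ ⊛_) (eq j)) (sym (trans (cong (_⊛ combK a′ v j) hom-1) (*-identityˡ _))) ⟩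
      (⟦ -1# ⟧ ⊛ combK a′ v j) ⊕ (⟦ 𝕂.1# ⟧ ⊛ combK a′ v j)
        ≡⟨ sym (distribʳ (combK a′ v j) _ _) ⟩
      (⟦ -1# ⟧ ⊕ ⟦ 𝕂.1# ⟧) ⊛ combK a′ v j
        ≡⟨ cong (_⊛ combK a′ v j) (trans (sym (hom-+ _ _)) (trans (cong ⟦_⟧ (𝕂.-‿inverseˡ 𝕂.1#)) hom-0)) ⟩
      0ᴸ ⊛ combK a′ v j
        ≡⟨ zeroˡ _ ⟩
      0ᴸ ∎) i
    a≡ : a i ≡ 𝕂.- (-1# 𝕂.* a i)
    a≡ = inverseʳ-unique _ _ (begin
      (-1# 𝕂.* a i) 𝕂.+ a i              ≡⟨ cong ((-1# 𝕂.* a i) 𝕂.+_) (sym (𝕂.*-identityˡ (a i))) ⟩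
      (-1# 𝕂.* a i) 𝕂.+ (𝕂.1# 𝕂.* a i)   ≡⟨ sym (𝕂.distribʳ (a i) -1# 𝕂.1#) ⟩
      (-1# 𝕂.+ 𝕂.1#) 𝕂.* a i             ≡⟨ cong (𝕂._* a i) (𝕂.-‿inverseˡ 𝕂.1#) ⟩
      𝕂.0# 𝕂.* a i                       ≡⟨ 𝕂.zeroˡ (a i) ⟩
      𝕂.0#                               ∎)

  δ : ∀ {t} → Fin t → Fin t → 𝕂.Carrier
  δ zero    zero    = 𝕂.1#
  δ zero    (suc _) = 𝕂.0#
  δ (suc _) zero    = 𝕂.0#
  δ (suc i) (suc j) = δ i j

  combK-δ : ∀ {s t} (v : Fin t → Vec s) i → combK (δ i) v ≋ v i
  combK-δ v zero    j = trans
    (cong₂ _⊕_ (trans (cong (_⊛ v zero j) hom-1) (*-identityˡ _)) (combK-zero (v ∘ suc) (λ _ → refl) j))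
    (+-identityʳ _)
  combK-δ v (suc i) j = trans
    (cong₂ _⊕_ (trans (cong (_⊛ v zero j) hom-0) (zeroˡ _)) (combK-δ (v ∘ suc) i j))
    (+-identityˡ _)

  InSpanK-member : ∀ {s t} (v : Fin t → Vec s) i → InSpanK (v i) v
  InSpanK-member v i = δ i , λ j → sym (combK-δ v i j)

  IndepK⇒SpanDimK : ∀ {s t} {v : Fin t → Vec s} → IndepK v → SpanDimK v t
  IndepK⇒SpanDimK {v = v} indep = v , indep , InSpanK-member v , InSpanK-member v

  -- The product of the row vector `a` with the matrix `M`, built one row at a time to match
  -- `combK-linear`.
  compose : ∀ {t u} → (Fin t → 𝕂.Carrier) → (Fin t → Fin u → 𝕂.Carrier) → Fin u → 𝕂.Carrier
  compose {zero}  a M j = 𝕂.0#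
  compose {suc t} a M j = a zero 𝕂.* M zero j 𝕂.+ compose (a ∘ suc) (M ∘ suc) j

  compose-zero : ∀ {t u} {a : Fin t → 𝕂.Carrier} (M : Fin t → Fin u → 𝕂.Carrier) →
                 (∀ i → a i ≡ 𝕂.0#) → ∀ j → compose a M j ≡ 𝕂.0#
  compose-zero {zero}  M a≗0 j = refl
  compose-zero {suc t} M a≗0 j = trans
    (cong₂ 𝕂._+_ (trans (cong (𝕂._* M zero j) (a≗0 zero)) (𝕂.zeroˡ _)) (compose-zero (M ∘ suc) (a≗0 ∘ suc) j))
    (𝕂.+-identityˡ _)

  combK-compose : ∀ {s t u} (a : Fin t → 𝕂.Carrier) (M : Fin t → Fin u → 𝕂.Carrier)
    {b : Fin t → Vec s} (v : Fin u → Vec s) → (∀ l → b l ≋ combK (M l) v) →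
    combK a b ≋ combK (compose a M) v
  combK-compose {t = zero}  a M v b≋ j = sym (combK-zero v (λ _ → refl) j)
  combK-compose {t = suc t} a M v b≋ j = trans
    (cong₂ _⊕_ (cong (⟦ a zero ⟧ ⊛_) (b≋ zero j)) (combK-compose (a ∘ suc) (M ∘ suc) v (b≋ ∘ suc) j))
    (sym (combK-linear (a zero) (M zero) (compose (a ∘ suc) (M ∘ suc)) v j))

  -- Elements of `L` enter as vectors of length one, the form in which `RankWeight` treats the
  -- entries of a word.
  Free : ∀ {t} → (Fin t → 𝕃) → Set
  Free v = IndepK {1} (λ i _ → v i)

  Free-cong : ∀ {t} {v w : Fin t → 𝕃} → v ≗ w → Free v → Free w
  Free-cong v≗w free a eq = free a (λ j →
    trans (Σ-cong (λ i → cong (⟦ a i ⟧ ⊛_) (v≗w i))) (eq j))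

  Free⇒≢0 : ∀ {t} (v : Fin t → 𝕃) → Free v → ∀ i → v i ≢ 0ᴸ
  Free⇒≢0 v free i vi≡0 = Field.0≢1 K (trans (sym (free (δ i) comb≡0 i)) (δ-diag i))
    where
    comb≡0 : combK {1} (δ i) (λ l _ → v l) ≋ zeroV
    comb≡0 j = trans (combK-δ (λ l _ → v l) i j) vi≡0
    δ-diag : ∀ {t} (l : Fin t) → δ l l ≡ 𝕂.1#
    δ-diag zero    = refl
    δ-diag (suc l) = δ-diag l

  combK-++ : ∀ {s t} (a : Fin (s + t) → 𝕂.Carrier) (u : Fin s → 𝕃) (w : Fin t → 𝕃) →
    sumL (s + t) (λ i → ⟦ a i ⟧ ⊛ (u ++ w) i)
      ≡ sumL s (λ i → ⟦ a (i ↑ˡ t) ⟧ ⊛ u i) ⊕ sumL t (λ i → ⟦ a (s ↑ʳ i) ⟧ ⊛ w i)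
  combK-++ {s} {t} a u w = trans (Σ-split s _)
    (cong₂ _⊕_ (Σ-cong (λ i → cong (⟦ a (i ↑ˡ t) ⟧ ⊛_) (lookup-++ˡ u w i)))
               (Σ-cong (λ i → cong (⟦ a (s ↑ʳ i) ⟧ ⊛_) (lookup-++ʳ u w i))))

  combK-scale : ∀ {t} c (a : Fin t → 𝕂.Carrier) (g : Fin t → 𝕃) →
    sumL t (λ i → ⟦ a i ⟧ ⊛ (c ⊛ g i)) ≡ c ⊛ sumL t (λ i → ⟦ a i ⟧ ⊛ g i)
  combK-scale {t} c a g = trans (Σ-cong (λ i → trans (sym (*-assoc _ _ _))
    (trans (cong (_⊛ g i) (*-comm _ _)) (*-assoc _ _ _)))) (Σ-⊛ˡ {t} c _)

  -- Direct sums of codes.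

  infixr 5 _⊞_
  -- The block diagonal generator matrix: the one-dimensional code spanned by `g`, plus the code of
  -- `G`.
  _⊞_ : ∀ {s k n} → (Fin s → 𝕃) → Matrix k n → Matrix (suc k) (s + n)
  (g ⊞ G) zero    = g ++ zeroV
  (g ⊞ G) (suc i) = zeroV ++ G i

  module _ {s k n} (g : Fin s → 𝕃) (G : Matrix k n) where

    ⊞-wordˡ : ∀ x i → combL x (g ⊞ G) (i ↑ˡ n) ≡ x zero ⊛ g i
    ⊞-wordˡ x i = trans
      (cong₂ _⊕_ (cong (x zero ⊛_) (lookup-++ˡ g zeroV i))
        (Σ-zero (λ l → trans (cong (x (suc l) ⊛_) (lookup-++ˡ {n = n} (zeroV {s}) (G l) i)) (zeroʳ _))))
      (+-identityʳ _)

    ⊞-wordʳ : ∀ x j → combL x (g ⊞ G) (s ↑ʳ j) ≡ combL (x ∘ suc) G j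
    ⊞-wordʳ x j = trans
      (cong₂ _⊕_ (trans (cong (x zero ⊛_) (lookup-++ʳ g zeroV j)) (zeroʳ _))
        (Σ-cong (λ l → cong (x (suc l) ⊛_) (lookup-++ʳ {m = s} zeroV (G l) j))))
      (+-identityˡ _)

    -- Row `zero` sees only the first block and the other rows only the second, so a relation among
    -- the columns splits into one for each block.
    ⊞-columns : Free g → IndepK (column G) → IndepK (column (g ⊞ G))
    ⊞-columns g-free G-indep a eq = ↑-elim (λ i → a i ≡ 𝕂.0#)
      (g-free (λ i → a (i ↑ˡ n)) (λ _ → begin
        sumL s (λ i → ⟦ a (i ↑ˡ n) ⟧ ⊛ g i)
          ≡⟨ sym (+-identityʳ _) ⟩
        sumL s (λ i → ⟦ a (i ↑ˡ n) ⟧ ⊛ g i) ⊕ 0ᴸ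
          ≡⟨ cong (sumL s (λ i → ⟦ a (i ↑ˡ n) ⟧ ⊛ g i) ⊕_) (sym (Σ-zero {n} (λ _ → zeroʳ _))) ⟩
        sumL s (λ i → ⟦ a (i ↑ˡ n) ⟧ ⊛ g i) ⊕ sumL n (λ j → ⟦ a (s ↑ʳ j) ⟧ ⊛ 0ᴸ)
          ≡⟨ sym (combK-++ a g zeroV) ⟩
        combK a (column (g ⊞ G)) zero
          ≡⟨ eq zero ⟩
        0ᴸ ∎))
      (G-indep (λ j → a (s ↑ʳ j)) (λ l → begin
        sumL n (λ j → ⟦ a (s ↑ʳ j) ⟧ ⊛ G l j)
          ≡⟨ sym (+-identityˡ _) ⟩
        0ᴸ ⊕ sumL n (λ j → ⟦ a (s ↑ʳ j) ⟧ ⊛ G l j)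
          ≡⟨ cong (_⊕ sumL n (λ j → ⟦ a (s ↑ʳ j) ⟧ ⊛ G l j)) (sym (Σ-zero {s} (λ _ → zeroʳ _))) ⟩
        sumL s (λ i → ⟦ a (i ↑ˡ n) ⟧ ⊛ 0ᴸ) ⊕ sumL n (λ j → ⟦ a (s ↑ʳ j) ⟧ ⊛ G l j)
          ≡⟨ sym (combK-++ a zeroV (G l)) ⟩
        combK a (column (g ⊞ G)) (suc l)
          ≡⟨ eq (suc l) ⟩
        0ᴸ ∎))

  -- On the first block the word is `x zero` times `g`. The block has positive length, and its first
  -- entry is nonzero by freeness, so `x zero` can be cancelled out.
  ⊞-rows : ∀ {s k n} {g : Fin (suc s) → 𝕃} {G : Matrix k n} →
           Free g → IsGenMatrix G → IsGenMatrix (g ⊞ G)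
  ⊞-rows {g = g} {G} g-free G-gen x eq zero =
    ⊛-nonzeroʳ (Free⇒≢0 g g-free zero) (trans (sym (⊞-wordˡ g G x zero)) (eq zero))
  ⊞-rows {s} {g = g} {G} g-free G-gen x eq (suc i) =
    G-gen (x ∘ suc) (λ j → trans (sym (⊞-wordʳ g G x j)) (eq (suc s ↑ʳ j))) i

  -- Words of prescribed weight in a direct sum.

  -- A codeword of weight t of a special form: t of its entries are independent, and every
  -- other entry is zero or repeats one of these.
  Reach : ∀ {k n} → Matrix k n → ℕ → Set
  Reach {k} {n} G t = ∃[ x ] ∃[ σ ] (Free {t} (combL x G ∘ σ)
    × (∀ j → combL x G j ≡ 0ᴸ ⊎ ∃[ l ] (combL x G j ≡ combL x G (σ l))))

  -- The entries at `σ` form a basis of the span of all entries. With at least one of them, the word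
  -- is nonzero.
  Reach⇒InWS : ∀ {k n} {G : Matrix k n} {t} → Reach G (suc t) → InWS G (suc t)
  Reach⇒InWS {G = G} (x , σ , free , cover) =
    combL x G , (x , λ _ → refl) , (λ c≋0 → Free⇒≢0 (combL x G ∘ σ) free zero (c≋0 (σ zero))) ,
    (λ l _ → combL x G (σ l)) , free , (λ l → InSpanK-member (λ j _ → combL x G j) (σ l)) , spans
    where
    spans : ∀ j → InSpanK {1} (λ _ → combL x G j) (λ l _ → combL x G (σ l))
    spans j with cover j
    ... | inj₁ eq       = (λ _ → 𝕂.0#) , λ i → trans eq (sym (combK-zero (λ l _ → combL x G (σ l)) (λ _ → refl) i))
    ... | inj₂ (l , eq) = δ l , λ i → trans eq (sym (combK-δ (λ l _ → combL x G (σ l)) l i))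

  Reach-skip : ∀ {s k n} (g : Fin s → 𝕃) {G : Matrix k n} {t} → Reach G t → Reach (g ⊞ G) t
  Reach-skip {s} {n = n} g {G} (x , σ , free , cover) =
    x′ , (s ↑ʳ_) ∘ σ , Free-cong (λ l → sym (⊞-wordʳ g G x′ (σ l))) free ,
    ↑-elim _ (λ i → inj₁ (trans (⊞-wordˡ g G x′ i) (zeroˡ _))) right
    where
    x′ = 0ᴸ ∷ x
    right : ∀ j → combL x′ (g ⊞ G) (s ↑ʳ j) ≡ 0ᴸ
          ⊎ ∃[ l ] (combL x′ (g ⊞ G) (s ↑ʳ j) ≡ combL x′ (g ⊞ G) (s ↑ʳ σ l))
    right j with cover j
    ... | inj₁ eq       = inj₁ (trans (⊞-wordʳ g G x′ j) eq)
    ... | inj₂ (l , eq) = inj₂ (l , trans (⊞-wordʳ g G x′ j) (trans eq (sym (⊞-wordʳ g G x′ (σ l)))))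

  -- Coefficient `c` on the new row contributes the entries of `c ⊛ g`; being independent together
  -- with the selected old entries, all `s` of them add to the weight.
  Reach-add : ∀ {s k n} (g : Fin s → 𝕃) {G : Matrix k n} {t} ((x , σ , _) : Reach G t) c →
              Free ((λ i → c ⊛ g i) ++ (combL x G ∘ σ)) → Reach (g ⊞ G) (s + t)
  Reach-add {s} {n = n} g {G} {t} (x , σ , _ , cover) c free =
    x′ , σ′ , Free-cong (λ i → sym (entries i)) free , ↑-elim _ left right
    where
    x′ = c ∷ x
    σ′ : Fin (s + t) → Fin (s + n)
    σ′ = (_↑ˡ n) ++ ((s ↑ʳ_) ∘ σ)
    entries : ∀ i → combL x′ (g ⊞ G) (σ′ i) ≡ ((λ i → c ⊛ g i) ++ (combL x G ∘ σ)) i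
    entries i with splitAt s i
    ... | inj₁ a = ⊞-wordˡ g G x′ a
    ... | inj₂ b = ⊞-wordʳ g G x′ (σ b)
    Covered : Fin (s + n) → Set
    Covered j = combL x′ (g ⊞ G) j ≡ 0ᴸ ⊎ ∃[ l ] (combL x′ (g ⊞ G) j ≡ combL x′ (g ⊞ G) (σ′ l))
    left : ∀ i → Covered (i ↑ˡ n)
    left i = inj₂ (i ↑ˡ t , cong (combL x′ (g ⊞ G)) (sym (lookup-++ˡ (_↑ˡ n) ((s ↑ʳ_) ∘ σ) i)))
    right : ∀ j → Covered (s ↑ʳ j)
    right j with cover j
    ... | inj₁ eq       = inj₁ (trans (⊞-wordʳ g G x′ j) eq)
    ... | inj₂ (l , eq) = inj₂ (s ↑ʳ l , trans (⊞-wordʳ g G x′ j) (trans eq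
      (trans (sym (⊞-wordʳ g G x′ (σ l)))
        (cong (combL x′ (g ⊞ G)) (sym (lookup-++ʳ (_↑ˡ n) ((s ↑ʳ_) ∘ σ) l))))))

-- Finite extensions: decidability and counting.

module Finite {K L : Field} (ι : FieldHom K L) {q m : ℕ}
              (K-size : HasSize K q) (L-size : HasSize L (q ^ m)) where
  open Ext ι
  open FieldHom ι
  open Linear ι
  open Enumeration K K-size renaming (_≟ᶠ_ to _≟ᴷ_; 1<size to 1<q)
  open Enumeration L L-size using ()
    renaming (_≟ᶠ_ to _≟ᴸ_; from-injective to fromᴸ-injective; to-injective to toᴸ-injective)
  open CommutativeRing (ring L)
    using (+-group; +-identityʳ; +-identityˡ; *-identityʳ; *-comm; *-assoc; zeroˡ; zeroʳ)
    renaming (Carrier to 𝕃; _+_ to _⊕_; _*_ to _⊛_; 0# to 0ᴸ; 1# to 1ᴸ)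
  open Inverse L-size using () renaming (to to toᴸ; from to fromᴸ)

  q^-≤⇒≤ : ∀ {a b} → q ^ a ≤ q ^ b → a ≤ b
  q^-≤⇒≤ {a} {b} le with a ≤? b
  ... | yes a≤b = a≤b
  ... | no  a≰b = ⊥-elim (<-irrefl refl (≤-trans (^-monoʳ-< q 1<q (≰⇒> a≰b)) le))

  Dependence : ∀ {s t} → (Fin t → Vec s) → (Fin t → 𝕂.Carrier) → Set
  Dependence v a = combK a v ≋ zeroV × ∃[ i ] (a i ≢ 𝕂.0#)

  -- Coefficient vectors are finite in number, so trying them all either proves independence or
  -- exhibits a dependence.
  independent? : ∀ {s t} (v : Fin t → Vec s) → IndepK v ⊎ ∃ (Dependence v)
  independent? {s} {t} v with any? {n = q ^ t} {P = Dependence v ∘ decode t}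
    (λ x → all? (λ j → combK (decode t x) v j ≟ᴸ 0ᴸ) ×-dec any? (λ i → ¬? (decode t x i ≟ᴷ 𝕂.0#)))
  ... | yes (x , dep) = inj₂ (decode t x , dep)
  ... | no  none      = inj₁ indep
    where
    indep : IndepK v
    indep a eq i with a i ≟ᴷ 𝕂.0#
    ... | yes ai≡0 = ai≡0
    ... | no  ai≢0 = ⊥-elim (none (encode a ,
      (λ j → trans (combK-congˡ v (decode-encode a) j) (eq j)) ,
      i , λ eq₀ → ai≢0 (trans (sym (decode-encode a i)) eq₀)))

  Free? : ∀ {t} (v : Fin t → 𝕃) → Dec (Free v)
  Free? v with independent? {1} (λ i _ → v i)
  ... | inj₁ free                = yes free
  ... | inj₂ (a , eq , i , ai≢0) = no λ free → ai≢0 (free a eq i)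

  -- Freeness makes the `q ^ t` combinations distinct elements of a field of size `q ^ m`.
  Free⇒≤ : ∀ {t} {v : Fin t → 𝕃} → Free v → t ≤ m
  Free⇒≤ {t} {v} free = q^-≤⇒≤ (injective⇒≤ {f = λ x → fromᴸ (value x)}
    λ eq → decode-injective t (combK-injective free (λ _ → fromᴸ-injective eq)))
    where
    value : Fin (q ^ t) → 𝕃
    value x = combK {1} (decode t x) (λ i _ → v i) zero

  -- A family of n vectors spanning a space of dimension n is independent: otherwise writing
  -- a basis in terms of the family gives an injection K^n → K^n that misses the dependence.
  SpanDimK⇒IndepK : ∀ {s n} {v : Fin n → Vec s} → SpanDimK v n → IndepK v
  SpanDimK⇒IndepK {n = n} {v} (b , b-indep , b-span , _) a av≡0 i with a i ≟ᴷ 𝕂.0#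
  ... | yes ai≡0 = ai≡0
  ... | no  ai≢0 = ⊥-elim (<-irrefl refl (injective∧missed⇒< f f-injective (encode a) missed))
    where
    M : Fin n → Fin n → 𝕂.Carrier
    M l = proj₁ (b-span l)
    f : Fin (q ^ n) → Fin (q ^ n)
    f x = encode (compose (decode n x) M)
    rewritten : ∀ x → combK (decode n x) b ≋ combK (compose (decode n x) M) v
    rewritten x = combK-compose (decode n x) M v (λ l → proj₂ (b-span l))
    f-injective : Injective _≡_ _≡_ f
    f-injective {x} {y} eq = decode-injective n (combK-injective b-indep (λ j →
      trans (rewritten x j) (trans (combK-congˡ v (encode-injective eq) j) (sym (rewritten y j)))))
    -- If `x` were sent to `a`, the combination of `b` with coefficients `x` would vanish, forcing
    -- `x` and then `a` to be zero.
    missed : ∀ x → f x ≢ encode a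
    missed x eq = ai≢0 (trans (sym (encode-injective eq i)) (compose-zero M x≡0 i))
      where
      x≡0 : ∀ l → decode n x l ≡ 𝕂.0#
      x≡0 = b-indep (decode n x) (λ j → trans (rewritten x j)
        (trans (combK-congˡ v (encode-injective eq) j) (av≡0 j)))

  -- If every c failed, choosing a dependence for each c would inject L into the nonzero
  -- vectors of K^(s+t): a dependence determines c, because g and b are free.
  scaled-complement : ∀ {s t} (g : Fin s → 𝕃) (b : Fin t → 𝕃) → Free g → Free b → s + t ≤ m →
                      ∃[ c ] Free ((λ i → c ⊛ g i) ++ b)
  scaled-complement {s} {t} g b g-free b-free s+t≤m
    with any? (λ x → Free? ((λ i → toᴸ x ⊛ g i) ++ b))
  ... | yes (x , free) = toᴸ x , free
  -- The injection misses zero, so `q ^ m < q ^ (s + t)`, against `s + t ≤ m`.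
  ... | no  none = ⊥-elim (<-irrefl refl (≤-trans
      (injective∧missed⇒< f f-injective (encode {s + t} (λ _ → 𝕂.0#)) missed)
      (^-monoʳ-≤ q {{>-nonZero (<⇒≤ 1<q)}} s+t≤m)))
    where
    family : 𝕃 → Fin (s + t) → 𝕃
    family c = (λ i → c ⊛ g i) ++ b
    dependence : ∀ x → ∃ (Dependence {1} (λ i _ → family (toᴸ x) i))
    dependence x with independent? {1} (λ i _ → family (toᴸ x) i)
    ... | inj₁ indep = ⊥-elim (none (x , indep))
    ... | inj₂ dep   = dep
    coeffs : Fin (q ^ m) → Fin (s + t) → 𝕂.Carrier
    coeffs x = proj₁ (dependence x)
    f : Fin (q ^ m) → Fin (q ^ (s + t))
    f x = encode (coeffs x)
    missed : ∀ x → f x ≢ encode {s + t} (λ _ → 𝕂.0#)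
    missed x eq = let (_ , _ , i , ai≢0) = dependence x in ai≢0 (encode-injective eq i)
    module _ (x : Fin (q ^ m)) where
      a = coeffs x
      ag = sumL s (λ i → ⟦ a (i ↑ˡ t) ⟧ ⊛ g i)
      ab = sumL t (λ i → ⟦ a (s ↑ʳ i) ⟧ ⊛ b i)
      relation : (toᴸ x ⊛ ag) ⊕ ab ≡ 0ᴸ
      relation = trans (cong (_⊕ ab) (sym (combK-scale (toᴸ x) _ g)))
        (trans (sym (combK-++ a _ b)) (proj₁ (proj₂ (dependence x)) zero))
      -- Otherwise the relation makes `ab` zero too, and freeness of `g` and `b` kills every
      -- coefficient.
      ag≢0 : ag ≢ 0ᴸ
      ag≢0 ag≡0 = let (_ , _ , i , ai≢0) = dependence x in
        ai≢0 (↑-elim (λ i → a i ≡ 𝕂.0#) (g-free _ (λ _ → ag≡0)) (b-free _ (λ _ → ab≡0)) i)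
        where
        ab≡0 : ab ≡ 0ᴸ
        ab≡0 = trans (sym (+-identityˡ ab))
          (trans (cong (_⊕ ab) (sym (trans (cong (toᴸ x ⊛_) ag≡0) (zeroʳ _)))) relation)
    -- Equal coefficients give equal `ag` and `ab`; cancelling `ab`, then the nonzero `ag`, recovers
    -- the scalar.
    f-injective : Injective _≡_ _≡_ f
    f-injective {x} {y} eq = toᴸ-injective (⊛-cancelʳ (ag≢0 x)
      (GroupProperties.∙-cancelʳ +-group (ab x) _ _ (trans (relation x)
        (sym (trans (cong₂ (λ u w → (toᴸ y ⊛ u) ⊕ w) ag-eq ab-eq) (relation y))))))
      where
      a≗ : coeffs x ≗ coeffs y
      a≗ = encode-injective eq
      ag-eq : ag x ≡ ag y
      ag-eq = Σ-cong (λ i → cong (λ e → ⟦ e ⟧ ⊛ g i) (a≗ (i ↑ˡ t)))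
      ab-eq : ab x ≡ ab y
      ab-eq = Σ-cong (λ i → cong (λ e → ⟦ e ⟧ ⊛ b i) (a≗ (s ↑ʳ i)))

  Free-1 : Free {1} (λ _ → 1ᴸ)
  Free-1 a eq zero with a zero ≟ᴷ 𝕂.0#
  ... | yes a≡0 = a≡0
  ... | no  a≢0 = ⊥-elim (hom-≢0 a≢0
    (trans (sym (trans (+-identityʳ _) (*-identityʳ _))) (eq zero)))

  -- Adds one element at a time: `scaled-complement`, applied to the family consisting of `1`,
  -- yields a scalar independent of those already chosen.
  Free-exists : ∀ s → s ≤ m → ∃ (Free {s})
  Free-exists zero    _   = (λ ()) , λ _ _ ()
  Free-exists (suc s) s<m =
    let b , b-free = Free-exists s (<⇒≤ s<m)
        c , free   = scaled-complement (λ _ → 1ᴸ) b Free-1 b-free s<m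
    in (λ (_ : Fin 1) → c ⊛ 1ᴸ) ++ b , free

  -- Codes attaining every possible weight.

  -- `Reach` is kept in place of `InWS` because adding a block needs explicit independent entries.
  -- Weight zero is included for words supported on the new block alone.
  FullCode : ℕ → ℕ → Set
  FullCode k n = ∃[ G ] (IsGenMatrix {k} {n} G × IndepK (column G)
    × (∀ t → t ≤ n → t ≤ m → Reach G t))

  FullCode-empty : FullCode 0 0
  FullCode-empty = (λ ()) , (λ _ _ ()) , (λ _ _ ()) , λ where
    .zero z≤n _ → (λ ()) , (λ ()) , (λ _ _ ()) , λ ()

  -- Weights up to `n` come from the old code, larger ones from a word of the old code plus a
  -- multiple of the new block. The condition `s ≤ n` ensures that no weight is skipped in between.
  FullCode-extend : ∀ {k n} s → suc s ≤ m → s ≤ n → FullCode k n → FullCode (suc k) (suc s + n)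
  FullCode-extend {k} {n} s s<m s≤n (G , G-gen , G-indep , G-reach) =
    g ⊞ G , ⊞-rows g-free G-gen , ⊞-columns g G g-free G-indep , reach
    where
    g = proj₁ (Free-exists (suc s) s<m)
    g-free = proj₂ (Free-exists (suc s) s<m)
    reach : ∀ t → t ≤ suc s + n → t ≤ m → Reach (g ⊞ G) t
    reach t t≤s+n t≤m with t ≤? n
    ... | yes t≤n = Reach-skip g (G-reach t t≤n t≤m)
    -- Since `s ≤ n < t`, the remainder `r` of `t` after the new block exists, and `t ≤ suc s + n`
    -- gives `r ≤ n`.
    ... | no  t≰n with m≤n⇒∃[o]m+o≡n (≤-trans (s≤s s≤n) (≰⇒> t≰n))
    ... | r , refl =
      let r≤n = +-cancelˡ-≤ (suc s) r n t≤s+n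
          R   = G-reach r r≤n (≤-trans (m≤n+m r (suc s)) t≤m)
          c , free = scaled-complement g _ g-free (proj₁ (proj₂ (proj₂ R))) t≤m
      in Reach-add g R c free

  FullCode-ones : 1 ≤ m → ∀ j → FullCode j j
  FullCode-ones 1≤m zero    = FullCode-empty
  FullCode-ones 1≤m (suc j) = FullCode-extend 0 1≤m z≤n (FullCode-ones 1≤m j)

  -- There are `r` blocks of length two over `suc j` blocks of length one; at least one of the
  -- latter must be present before a block of length two can be added.
  FullCode-twos : 2 ≤ m → ∀ r j → FullCode (suc (r + j)) (suc (r * 2 + j))
  FullCode-twos 2≤m zero    j = FullCode-ones (<⇒≤ 2≤m) (suc j)
  FullCode-twos 2≤m (suc r) j = FullCode-extend 1 2≤m (s≤s z≤n) (FullCode-twos 2≤m r j)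

  -- If `n < k + k`, the excess `r` of `n` over `k` is the number of blocks of length two, and the
  -- other `suc j` blocks have length one.
  FullCode-exists : 3 ≤ m → ∀ k n → k ≤ n → n ≤ k + k → 5 ≤ n → FullCode k n
  FullCode-exists 3≤m k n k≤n n≤2k 5≤n with n <? k + k
  FullCode-exists 3≤m k n k≤n n≤2k 5≤n | yes n<2k with m≤n⇒∃[o]m+o≡n k≤n
  ... | r , refl with m≤n⇒∃[o]m+o≡n (+-cancelˡ-< k r k n<2k)
  ... | j , refl = subst (FullCode (suc (r + j))) length-eq (FullCode-twos (<⇒≤ 3≤m) r j)
    where
    open ℕ-Solver.+-*-Solver
    length-eq : suc (r * 2 + j) ≡ suc (r + j) + r
    length-eq = solve 2 (λ r j → con 1 :+ (r :* con 2 :+ j) := con 1 :+ (r :+ j) :+ r) refl r j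
  FullCode-exists 3≤m k n k≤n n≤2k 5≤n | no n≮2k with ℕ.≤-antisym n≤2k (≮⇒≥ n≮2k)
  FullCode-exists 3≤m 0 n k≤n n≤2k () | no n≮2k | refl
  FullCode-exists 3≤m 1 n k≤n n≤2k (s≤s (s≤s ())) | no n≮2k | refl
  FullCode-exists 3≤m 2 n k≤n n≤2k (s≤s (s≤s (s≤s (s≤s ())))) | no n≮2k | refl
  -- With only blocks of length two, every nonzero word would have weight at least two. So one block
  -- gets length one and another length three; the latter is added last, to a code of length at
  -- least three, which is where `k ≥ 3` enters.
  FullCode-exists 3≤m (suc (suc (suc r))) n k≤n n≤2k 5≤n | no n≮2k | refl =
    subst₂ FullCode dim-eq length-eq
      (FullCode-extend 2 3≤m (s≤s (s≤s z≤n)) (FullCode-twos (<⇒≤ 3≤m) (suc r) 0))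
    where
    open ℕ-Solver.+-*-Solver
    dim-eq : 3 + (r + 0) ≡ 3 + r
    dim-eq = cong (3 +_) (ℕ.+-identityʳ r)
    length-eq : 3 + suc (2 + r * 2 + 0) ≡ (3 + r) + (3 + r)
    length-eq = solve 1 (λ r → con 3 :+ (con 1 :+ (con 2 :+ r :* con 2 :+ con 0)) := (con 3 :+ r) :+ (con 3 :+ r)) refl r

  -- Weight spectra and optimal codes.

  InWS⇒≤ : ∀ {k n} {G : Matrix k n} {w} → InWS G w → w ≤ m
  InWS⇒≤ (_ , _ , _ , b , b-indep , _) =
    Free⇒≤ (λ a eq → b-indep a (λ { zero → eq zero }))

  InWS⇒≢0 : ∀ {k n} {G : Matrix k n} {w} → InWS G w → w ≢ 0
  InWS⇒≢0 (c , _ , c≢0 , b , _ , _ , c-span) refl = c≢0 (λ j → proj₂ (c-span j) zero)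

  FullCode⇒WSSize : ∀ {k n} ((G , _) : FullCode k n) → m ≤ n → WSSize G m
  FullCode⇒WSSize (G , _ , _ , reach) m≤n =
    suc ∘ toℕ ,
    (λ i → Reach⇒InWS (reach (suc (toℕ i)) (≤-trans (toℕ<n i) m≤n) (toℕ<n i))) ,
    toℕ-injective ∘ suc-injective , surj
    where
    surj : ∀ w → InWS G w → ∃[ i ] (suc (toℕ i) ≡ w)
    surj zero    ws = ⊥-elim (InWS⇒≢0 ws refl)
    surj (suc w) ws = fromℕ< (InWS⇒≤ ws) , cong suc (toℕ-fromℕ< (InWS⇒≤ ws))

  -- All weights lie between 1 and `m`, so a spectrum without 1 has fewer than `m` elements, whereas
  -- the full code attains `m`.
  optimal⇒weight-one : ∀ {k n} → 1 ≤ m → m ≤ n → FullCode k n →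
                       ∀ {G : Matrix k n} → LrkOptimal n k G → InWS G 1
  optimal⇒weight-one {k} {n} 1≤m m≤n full@(F , F-gen , F-indep , _) {G}
    (_ , N , (_ , maximal) , f , f-ws , f-inj , _) with any? (λ i → f i ≟ 1)
  ... | yes (i , fi≡1) = subst (InWS G) fi≡1 (f-ws i)
  ... | no  none = ⊥-elim (<-irrefl refl (≤-trans N<m
      (maximal F F-gen (IndepK⇒SpanDimK F-indep) m (FullCode⇒WSSize full m≤n))))
    where
    pred-f : ∀ i → ∃[ w ] (f i ≡ suc w × w < m)
    pred-f i with f i | f-ws i
    ... | zero  | ws = ⊥-elim (InWS⇒≢0 ws refl)
    ... | suc w | ws = w , refl , InWS⇒≤ ws
    -- Weights are shifted down by one, so a missing weight 1 becomes a missed index zero.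
    h : Fin N → Fin m
    h i = fromℕ< (proj₂ (proj₂ (pred-f i)))
    value : ∀ i → f i ≡ suc (toℕ (h i))
    value i = trans (proj₁ (proj₂ (pred-f i))) (cong suc (sym (toℕ-fromℕ< _)))
    N<m : N < m
    N<m = injective∧missed⇒< h
      (λ {i} {j} eq → f-inj (trans (value i) (trans (cong (suc ∘ toℕ) eq) (sym (value j)))))
      (fromℕ< 1≤m)
      (λ i eq → none (i , trans (value i) (cong suc (trans (cong toℕ eq) (toℕ-fromℕ< 1≤m)))))

  -- Duality and degeneracy.

  -- The word is `μ` times a vector `α` over `K`. Cancelling `μ` from its orthogonality to the rows
  -- of `B` leaves a relation over `K` among the columns of `B`.
  weight-one⇒degenerate : ∀ {k k′ n} {A : Matrix k n} {B : Matrix k′ n} →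
    (∀ c → InCode A c → ∀ i → dot c (B i) ≡ 0ᴸ) → InWS A 1 → ¬ Nondegenerate B
  weight-one⇒degenerate {n = n} {B = B} orthogonal (c , c∈A , c≢0 , b , _ , _ , c-span) nondeg =
    c≢0 (λ j → trans (c≡ j) (trans (cong (_⊛ μ) (trans (cong ⟦_⟧ (α≡0 j)) hom-0)) (zeroˡ μ)))
    where
    μ = b zero zero
    α : Fin n → 𝕂.Carrier
    α j = proj₁ (c-span j) zero
    c≡ : ∀ j → c j ≡ ⟦ α j ⟧ ⊛ μ
    c≡ j = trans (proj₂ (c-span j) zero) (+-identityʳ _)
    μ≢0 : μ ≢ 0ᴸ
    μ≢0 μ≡0 = c≢0 (λ j → trans (c≡ j) (trans (cong (⟦ α j ⟧ ⊛_) μ≡0) (zeroʳ _)))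
    scaled : ∀ i → μ ⊛ combK α (column B) i ≡ dot c (B i)
    scaled i = trans (sym (Σ-⊛ˡ {n} μ _)) (Σ-cong (λ j →
      trans (sym (*-assoc _ _ _)) (cong (_⊛ B i j) (trans (*-comm μ _) (sym (c≡ j))))))
    α≡0 : ∀ j → α j ≡ 𝕂.0#
    α≡0 = SpanDimK⇒IndepK nondeg α (λ i → ⊛-nonzeroʳ μ≢0
      (trans (*-comm _ μ) (trans (scaled i) (orthogonal c c∈A i))))

  dot-comm : ∀ {n} (c d : Vec n) → dot c d ≡ dot d c
  dot-comm c d = Σ-cong (λ i → *-comm (c i) (d i))

  row-InCode : ∀ {k n} (G : Matrix k n) i → InCode G (G i)
  row-InCode G i = (λ l → ⟦ δ i l ⟧) , proj₂ (InSpanK-member G i)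

  -- If `n ≤ k + k`, optimality of `G` contradicts nondegeneracy of `H`; otherwise `n ∸ k` is the
  -- large dimension, and optimality of `H` contradicts nondegeneracy of `G`.
  dual-not-optimal : 3 ≤ m → ∀ {n k} → 5 ≤ n → m ≤ n → k < n →
    (G : Matrix k n) → Nondegenerate G → LrkOptimal n k G →
    (H : Matrix (n ∸ k) n) → GeneratesDual G H →
    ¬ (Nondegenerate H × LrkOptimal n (n ∸ k) H)
  dual-not-optimal 3≤m {n} {k} 5≤n m≤n k<n G G-nondeg G-opt H (_ , dual) (H-nondeg , H-opt)
    with n ≤? k + k
  ... | yes n≤2k = weight-one⇒degenerate {A = G} {B = H}
      (λ c c∈G i → proj₁ (dual (H i)) (row-InCode H i) c c∈G)
      (optimal⇒weight-one 1≤m m≤n (FullCode-exists 3≤m k n (<⇒≤ k<n) n≤2k 5≤n) G-opt)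
      H-nondeg
    where
    1≤m = ≤-trans (s≤s z≤n) 3≤m
  ... | no  n≰2k = weight-one⇒degenerate {A = H} {B = G}
      (λ d d∈H i → trans (dot-comm d (G i)) (proj₁ (dual d) d∈H (G i) (row-InCode G i)))
      (optimal⇒weight-one 1≤m m≤n (FullCode-exists 3≤m (n ∸ k) n (ℕ.m∸n≤m n k) n≤2k′ 5≤n) H-opt)
      G-nondeg
    where
    1≤m = ≤-trans (s≤s z≤n) 3≤m
    k+k′≡n : k + (n ∸ k) ≡ n
    k+k′≡n = m+[n∸m]≡n (<⇒≤ k<n)
    k≤k′ : k ≤ n ∸ k
    k≤k′ = <⇒≤ (+-cancelˡ-< k k (n ∸ k) (≤-trans (≰⇒> n≰2k) (≤-reflexive (sym k+k′≡n))))
    n≤2k′ : n ≤ (n ∸ k) + (n ∸ k)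
    n≤2k′ = ≤-trans (≤-reflexive (sym k+k′≡n)) (+-monoˡ-≤ (n ∸ k) k≤k′)

theoremA6 : (q m n k : ℕ) → IsPrimePower q
    → 1 < k → k < n → m < n → n ≤ k * m
    → (4 ≤ m ⊎ (m ≡ 3 × 5 ≤ n))
    → (Fq Fqm : Field) → HasSize Fq q → HasSize Fqm (q ^ m)
    → (ι : FieldHom Fq Fqm)
    → (G : Ext.Matrix ι k n) → Ext.IsCode ι n k G
    → Ext.Nondegenerate ι G → Ext.LrkOptimal ι n k G
    → (H : Ext.Matrix ι (n ∸ k) n) → Ext.GeneratesDual ι G H
    → ¬ (Ext.Nondegenerate ι H × Ext.LrkOptimal ι n (n ∸ k) H)
theoremA6 q m n k _ _ k<n m<n _ bounds Fq Fqm Fq-size Fqm-size ι G _ G-nondeg G-opt H dual =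
  Finite.dual-not-optimal ι Fq-size Fqm-size (3≤m bounds) (5≤n bounds) (<⇒≤ m<n) k<n
    G G-nondeg G-opt H dual
  where
  3≤m : 4 ≤ m ⊎ (m ≡ 3 × 5 ≤ n) → 3 ≤ m
  3≤m (inj₁ 4≤m)        = <⇒≤ 4≤m
  3≤m (inj₂ (refl , _)) = ≤-refl
  5≤n : 4 ≤ m ⊎ (m ≡ 3 × 5 ≤ n) → 5 ≤ n
  5≤n (inj₁ 4≤m)      = ≤-trans (s≤s 4≤m) m<n
  5≤n (inj₂ (_ , le)) = le
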